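{- The collection of all abstract factorials forms a commutative semigroup under ordinary (pointwise) multiplication of functions $\mathbb{N}\to\mathbb{Z}^+$.
   Context: $\mathbb{N}=\{0,1,2,\dots\}$ and $\mathbb{Z}^+=\{1,2,3,\dots\}$. An abstract factorial is a function $!_{a}:\mathbb{N}\to\mathbb{Z}^+$, $n\mapsto n!_{a}$, such that: (1) $0!_{a}=1$; (2) for all integers $0\le k\le n$, the generalized binomial coefficient $\binom{n}{k}_{a}:=\frac{n!_{a}}{k!_{a}\,(n-k)!_{a}}$ is a positive integer; (3) for every positive integer $n$, the ordinary factorial $n!$ divides $n!_{a}$. -}

module Defs where

open import Data.Integer.Base using (+_)
open import Data.Nat.Base using (ℕ; _*_; _∸_; _≤_; NonZero; _!)
open import Data.Nat.Divisibility using (_∣_)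
open import Data.Nat.Properties using (m*n≢0)
open import Data.Product.Base using (∃; _,_; proj₁)
open import Data.Rational.Base using (ℚ; _/_)
open import Function.Base using (_on_)
open import Relation.Binary.Core using (Rel)
open import Relation.Binary.PropositionalEquality using (_≡_; _≗_)
open import Level using (0ℓ)

infixl 7 _*⁺_ _·_
infix  4 _≈_

record ℤ⁺ : Set where
  constructor pos
  field
    value       : ℕ
    {{nonZero}} : NonZero value

open ℤ⁺ public

_*⁺_ : ℤ⁺ → ℤ⁺ → ℤ⁺
a *⁺ b = pos (value a * value b) {{m*n≢0 (value a) (value b) {{nonZero a}} {{nonZero b}}}}

_·_ : (ℕ → ℤ⁺) → (ℕ → ℤ⁺) → (ℕ → ℤ⁺)
(f · g) n = f n *⁺ g n

-- Intended for k ≤ n only, where n ∸ k is the true difference.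
binomial : (ℕ → ℤ⁺) → ℕ → ℕ → ℚ
binomial f n k = _/_ (+ value (f n)) (value d) {{nonZero d}}
  where
  d : ℤ⁺
  d = f k *⁺ f (n ∸ k)

IsPositiveInteger : ℚ → Set
IsPositiveInteger q = ∃ λ (m : ℤ⁺) → q ≡ + value m / 1

record IsAbstractFactorial (f : ℕ → ℤ⁺) : Set where
  field
    zero-value        : f 0 ≡ pos 1
    binomial-integral : ∀ n k → k ≤ n → IsPositiveInteger (binomial f n k)
    !-divides         : ∀ n → {{NonZero n}} → n ! ∣ value (f n)

AbstractFactorial : Set
AbstractFactorial = ∃ IsAbstractFactorial

-- Equality of the underlying functions, taken pointwise since function
-- extensionality is not available; the membership proofs are ignored.
_≈_ : Rel AbstractFactorial 0ℓ
_≈_ = _≗_ on proj₁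

ClosedUnderProduct : Set
ClosedUnderProduct = ∀ f g → IsAbstractFactorial f → IsAbstractFactorial g → IsAbstractFactorial (f · g)

product : ClosedUnderProduct → AbstractFactorial → AbstractFactorial → AbstractFactorial
product closed (f , f-af) (g , g-af) = f · g , closed f g f-af g-af

{-# OPTIONS --safe #-}
module Submission where

open import Defs
open import Algebra.Structures using (IsCommutativeSemigroup)
open import Data.Integer.Base using (+_)
import Data.Integer.Base as ℤ
open import Data.Integer.Properties using (pos-*)
open import Data.Nat.Base using (ℕ; suc; _*_; _∸_; _≤_; NonZero)
open import Data.Nat.Divisibility using (∣m⇒∣m*n)
open import Data.Nat.Properties
  using (*-assoc; *-comm; *-identityʳ; [m*n]*[o*p]≡[m*o]*[n*p])
open import Data.Product.Base using (Σ; _,_; proj₁)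
open import Data.Rational.Base using (_/_)
open import Data.Rational.Properties using (fromℚᵘ-cong; normalize-injective-≃)
open import Data.Rational.Unnormalised.Base using (mkℚᵘ; *≡*)
open import Relation.Binary.Construct.On using (isEquivalence)
open import Relation.Binary.PropositionalEquality
  using (_≡_; refl; sym; trans; cong; cong₂; _→-setoid_; module ≡-Reasoning)
open import Relation.Binary.Bundles using (Setoid)

-- The generalized binomial coefficient is multiplicative in the factorial: that of `f · g` is the
-- product of those of `f` and `g`, so positive integrality survives products. `/≡/1⇒≡*` and
-- `≡*⇒/≡/1` move this computation from ℚ to ℕ. The semigroup laws hold pointwise because they hold
-- in `ℤ⁺`.

-- Once the value is a successor, `NonZero` reduces to a unit type, so the two proofs agree
-- definitionally.
value-injective : ∀ {a b} → value a ≡ value b → a ≡ b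
value-injective {pos (suc _)} {pos (suc _)} refl = refl

*⁺-assoc : ∀ a b c → (a *⁺ b) *⁺ c ≡ a *⁺ (b *⁺ c)
*⁺-assoc a b c = value-injective (*-assoc (value a) (value b) (value c))

*⁺-comm : ∀ a b → a *⁺ b ≡ b *⁺ a
*⁺-comm a b = value-injective (*-comm (value a) (value b))

-- Equal normalized fractions have equal cross products, here `m * 1` and `k * d`.
/≡/1⇒≡* : ∀ m d k {{_ : NonZero d}} → + m / d ≡ + k / 1 → m ≡ k * d
/≡/1⇒≡* m d k eq = trans (sym (*-identityʳ m)) (normalize-injective-≃ m k d 1 eq)

≡*⇒/≡/1 : ∀ m d k .{{_ : NonZero d}} → m ≡ k * d → + m / d ≡ + k / 1
-- `mkℚᵘ` stores the denominator minus one: `d` stands for `suc d` and `0` for `1`.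
≡*⇒/≡/1 m (suc d) k eq = fromℚᵘ-cong {mkℚᵘ (+ m) d} {mkℚᵘ (+ k) 0} (*≡* (begin
  + m ℤ.* + 1        ≡⟨ pos-* m 1 ⟨
  + (m * 1)          ≡⟨ cong +_ (trans (*-identityʳ m) eq) ⟩
  + (k * suc d)      ≡⟨ pos-* k (suc d) ⟩
  + k ℤ.* + suc d    ∎))
  where open ≡-Reasoning

·-closed : ClosedUnderProduct
·-closed f g f-af g-af = record
  { zero-value        = cong₂ _*⁺_ F.zero-value G.zero-value
  ; binomial-integral = integral
  -- The ordinary factorial divides `f n`, hence also its multiple `f n * g n`.
  ; !-divides         = λ n → ∣m⇒∣m*n (value (g n)) (F.!-divides n)
  }
  where
  module F = IsAbstractFactorial f-af
  module G = IsAbstractFactorial g-af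
  open ≡-Reasoning

  integral : ∀ n k → k ≤ n → IsPositiveInteger (binomial (f · g) n k)
  integral n k k≤n with F.binomial-integral n k k≤n | G.binomial-integral n k k≤n
  ... | p , f-eq | q , g-eq =
    p *⁺ q , ≡*⇒/≡/1 (value (f n *⁺ g n)) (value d) (value (p *⁺ q)) {{nonZero d}} (begin
      value (f n) * value (g n)
        ≡⟨ cong₂ _*_ (/≡/1⇒≡* (value (f n)) (value dᶠ) (value p) {{nonZero dᶠ}} f-eq)
                     (/≡/1⇒≡* (value (g n)) (value dᵍ) (value q) {{nonZero dᵍ}} g-eq) ⟩
      (value p * value dᶠ) * (value q * value dᵍ)
        ≡⟨ [m*n]*[o*p]≡[m*o]*[n*p] (value p) (value dᶠ) (value q) (value dᵍ) ⟩
      (value p * value q) * (value dᶠ * value dᵍ)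
        -- The denominators are regrouped: by function in `dᶠ` and `dᵍ`, by argument `k` or `n ∸ k`
        -- in `d`.
        ≡⟨ cong (value p * value q *_)
             ([m*n]*[o*p]≡[m*o]*[n*p] (value (f k)) (value (f (n ∸ k)))
                                      (value (g k)) (value (g (n ∸ k)))) ⟩
      (value p * value q) * value d ∎)
    where
    dᶠ dᵍ d : ℤ⁺
    dᶠ = f k *⁺ f (n ∸ k)
    dᵍ = g k *⁺ g (n ∸ k)
    d  = (f · g) k *⁺ (f · g) (n ∸ k)

-- Since `_≈_` compares only underlying functions, the membership proofs built by `·-closed` never
-- enter the laws.
proposition3 : Σ ClosedUnderProduct (λ closed → IsCommutativeSemigroup _≈_ (product closed))
proposition3 = ·-closed , record
  { isSemigroup = record
    { isMagma = record
      { isEquivalence = isEquivalence proj₁ (Setoid.isEquivalence (ℕ →-setoid ℤ⁺))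
      ; ∙-cong        = λ f≈f′ g≈g′ n → cong₂ _*⁺_ (f≈f′ n) (g≈g′ n)
      }
    ; assoc = λ (f , _) (g , _) (h , _) n → *⁺-assoc (f n) (g n) (h n)
    }
  ; comm = λ (f , _) (g , _) n → *⁺-comm (f n) (g n)
  }
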